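{- Let $d\ge 3$ be an integer. If $D$ is a sourceless $\vec{K}_{1,d}$-free digraph with $n$ vertices, then $D$ contains a quasi-kernel of order at most $\frac{(d^2-2d+2)n}{d^2-d+1}$.
   Context: Digraphs are finite, without loops and without repeated edges $(u,v)$; both $(u,v)$ and $(v,u)$ may be present. A source is a vertex with in-degree zero; a digraph is sourceless if it has no source. $\vec{K}_{1,d}$ is the orientation of the star $K_{1,d}$ with all edges directed away from the centre (the vertex of degree $d$). A digraph $D$ is $H$-free if $H$ is not an induced subgraph of $D$. $\dist(v,u)$ is the length of a shortest directed path from $v$ to $u$ ($\infty$ if none exists). A quasi-kernel of $D$ is an independent set $Q$ (no edges in either direction between vertices of $Q$) such that for every vertex $u$ of $D$ there is $v\in Q$ with $\dist(v,u)\le 2$. -}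

module Defs where

open import Data.Fin.Base using (Fin; zero; suc; inject₁; fromℕ)
open import Data.Fin.Subset using (Subset; _∈_; ∣_∣)
open import Data.Nat.Base using (ℕ; zero; suc; _≤_)
open import Data.Product.Base using (∃-syntax; _×_)
open import Data.Vec.Base using (tabulate)
open import Function.Bundles using (_⇔_)
open import Function.Definitions using (Injective)
open import Relation.Binary.Core using (Rel)
open import Relation.Binary.Definitions using (Decidable)
open import Relation.Binary.PropositionalEquality using (_≡_)
open import Relation.Nullary using (¬_; does; yes; no)
open import Level using (0ℓ)

-- Edges are a relation, so there are no multiplicities; decidability of
-- the relation is what makes it a (constructively) finite edge set.
record Digraph (n : ℕ) : Set₁ where
  field
    Edge     : Rel (Fin n) 0ℓ
    edge?    : Decidable Edge
    loopless : ∀ v → ¬ Edge v v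

open Digraph public

inNeighbours : ∀ {n} → Digraph n → Fin n → Subset n
inNeighbours D u = tabulate (λ v → does (edge? D v u))

inDegree : ∀ {n} → Digraph n → Fin n → ℕ
inDegree D u = ∣ inNeighbours D u ∣

IsSource : ∀ {n} → Digraph n → Fin n → Set
IsSource D u = inDegree D u ≡ 0

Sourceless : ∀ {n} → Digraph n → Set
Sourceless D = ¬ (∃[ u ] IsSource D u)

-- The centre is zero and the leaves are suc i for i : Fin d.
data StarEdge {d : ℕ} : Rel (Fin (suc d)) 0ℓ where
  centre→leaf : ∀ i → StarEdge zero (suc i)

K⃗₁ : (d : ℕ) → Digraph (suc d)
K⃗₁ d = record
  { Edge     = StarEdge
  ; edge?    = λ { zero    zero    → no λ ()
                 ; zero    (suc i) → yes (centre→leaf i)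
                 ; (suc _) _       → no λ ()
                 }
  ; loopless = λ _ ()
  }

-- H is an induced subgraph of D up to isomorphism.
InducedSubgraph : ∀ {m n} → Digraph m → Digraph n → Set
InducedSubgraph {m} {n} H D =
  ∃[ f ] Injective _≡_ _≡_ f × (∀ (i j : Fin m) → Edge H i j ⇔ Edge D (f i) (f j))

_IsFreeOf_ : ∀ {m n} → Digraph n → Digraph m → Set
D IsFreeOf H = ¬ InducedSubgraph H D

record Path {n} (D : Digraph n) (v u : Fin n) (k : ℕ) : Set where
  field
    vertex   : Fin (suc k) → Fin n
    start    : vertex zero ≡ v
    end      : vertex (fromℕ k) ≡ u
    step     : ∀ (i : Fin k) → Edge D (vertex (inject₁ i)) (vertex (suc i))
    distinct : Injective _≡_ _≡_ vertex

-- dist(v , u) = k.  Infinite distance is the absence of any such k.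
IsDist : ∀ {n} → Digraph n → Fin n → Fin n → ℕ → Set
IsDist D v u k = Path D v u k × (∀ l → Path D v u l → k ≤ l)

-- dist(v , u) ≤ m.
Dist≤ : ∀ {n} → Digraph n → Fin n → Fin n → ℕ → Set
Dist≤ D v u m = ∃[ k ] IsDist D v u k × k ≤ m

-- Both orders of u and v are covered by the quantification.
Independent : ∀ {n} → Digraph n → Subset n → Set
Independent D Q = ∀ u v → u ∈ Q → v ∈ Q → ¬ Edge D u v

IsQuasiKernel : ∀ {n} → Digraph n → Subset n → Set
IsQuasiKernel D Q = Independent D Q × (∀ u → ∃[ v ] v ∈ Q × Dist≤ D v u 2)

{-# OPTIONS --safe #-}
-- Take an inclusion-minimal quasi-kernel Q.  Since no q ∈ Q can be dropped,
-- every q ∈ Q has a vertex x ∉ Q such that either q is the only in-neighbour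
-- of x in Q, or x is an in-neighbour of q having no in-neighbour in Q.
-- For a given x the first case concerns at most one q; in the second case the
-- out-neighbours of x in Q form an induced out-star with centre x, so there
-- are at most d - 1 of them.  Hence |Q| ≤ (d - 1)(n - |Q|), which is stronger
-- than the stated bound.
module Submission where

open import Data.Fin.Base using (Fin; zero; suc)
open import Data.Fin.Properties using (_≟_; any?; all?; suc-injective; ¬∀⟶∃¬)
open import Data.Fin.Subset
  using (Subset; inside; outside; _∈_; _⊆_; _⊂_; ⊥; ⊤; ⁅_⁆; ∁; _∪_; _∩_; _-_; ∣_∣; Nonempty; Empty)
open import Data.Fin.Subset.Induction using (⊂-wellFounded; Acc; acc)
open import Data.Fin.Subset.Properties
import Data.Integer.Base as ℤ
open import Data.Integer.Base using (+_; +≤+)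
open import Data.Integer.Properties using (pos-*)
import Data.Nat.Base as ℕ
open import Data.Nat.Base using (ℕ; zero; suc; z≤n; s≤s; _≥_; _+_; _*_; _^_; _∸_)
import Data.Nat.Properties as ℕ
open import Data.Nat.Tactic.RingSolver using (solve-∀)
open import Data.Product.Base using (∃-syntax; _×_; _,_; proj₁; proj₂)
open import Data.Rational.Unnormalised.Base using (_≤_; _/_; *≤*)
open import Data.Sum.Base using (_⊎_; inj₁; inj₂)
open import Data.Vec.Base using ([]; _∷_; tabulate; here; there)
import Data.Vec.Functional as Functional
open import Data.Vec.Properties using (lookup∘tabulate; lookup⇒[]=; []=⇒lookup)
open import Function.Base using (_∘_)
open import Function.Bundles using (mk⇔)
open import Function.Definitions using (Injective)
open import Relation.Binary.PropositionalEquality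
open import Relation.Nullary using (¬_; Dec; yes; no; does; contradiction)
open import Relation.Nullary.Decidable using (_×-dec_; _⊎-dec_; ¬?; dec-true)
open import Relation.Unary using (Pred; Decidable)
open import Defs

-- Subsets of Fin n

select : ∀ {n p} {P : Pred (Fin n) p} → Decidable P → Subset n
select P? = tabulate (does ∘ P?)

∈-select⁺ : ∀ {n p} {P : Pred (Fin n) p} (P? : Decidable P) {x} → P x → x ∈ select P?
∈-select⁺ P? {x} px =
  lookup⇒[]= x _ (trans (lookup∘tabulate (does ∘ P?) x) (dec-true (P? x) px))

∈-select⁻ : ∀ {n p} {P : Pred (Fin n) p} (P? : Decidable P) {x} → x ∈ select P? → P x
∈-select⁻ P? {x} x∈ with P? x | trans (sym (lookup∘tabulate (does ∘ P?) x)) ([]=⇒lookup x∈)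
... | yes px | _ = px
... | no _   | ()

Empty⇒∣p∣≡0 : ∀ {n} {p : Subset n} → Empty p → ∣ p ∣ ≡ 0
Empty⇒∣p∣≡0 {n} empty = trans (cong ∣_∣ (Empty-unique empty)) (∣⊥∣≡0 n)

∣p∣≤∣q∣+∣p∩∁q∣ : ∀ {n} (p q : Subset n) → ∣ p ∣ ℕ.≤ ∣ q ∣ + ∣ p ∩ ∁ q ∣
∣p∣≤∣q∣+∣p∩∁q∣ []            []            = z≤n
∣p∣≤∣q∣+∣p∩∁q∣ (inside  ∷ p) (inside  ∷ q) = s≤s (∣p∣≤∣q∣+∣p∩∁q∣ p q)
∣p∣≤∣q∣+∣p∩∁q∣ (inside  ∷ p) (outside ∷ q)
  rewrite ℕ.+-suc ∣ q ∣ ∣ p ∩ ∁ q ∣        = s≤s (∣p∣≤∣q∣+∣p∩∁q∣ p q)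
∣p∣≤∣q∣+∣p∩∁q∣ (outside ∷ p) (inside  ∷ q) = ℕ.m≤n⇒m≤1+n (∣p∣≤∣q∣+∣p∩∁q∣ p q)
∣p∣≤∣q∣+∣p∩∁q∣ (outside ∷ p) (outside ∷ q) = ∣p∣≤∣q∣+∣p∩∁q∣ p q

-- A union bound by induction on `p`: the head of `p` accounts for at most `k` elements of `q`, and
-- the elements outside its fibre have their partners in the tail. As `R` is an arbitrary relation,
-- a fibre is represented by a subset `f` that contains it.
fibres-bound : ∀ {m n r} k (R : Fin n → Fin m → Set r) (q : Subset n) (p : Subset m) →
  (∀ y → y ∈ q → ∃[ x ] x ∈ p × R y x) →
  (∀ x → x ∈ p → ∃[ f ] ∣ f ∣ ℕ.≤ k × (∀ y → y ∈ q → R y x → y ∈ f)) →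
  ∣ q ∣ ℕ.≤ ∣ p ∣ * k
fibres-bound k R q [] image fibre = ℕ.≤-reflexive (Empty⇒∣p∣≡0 empty)
  where
  empty : Empty q
  empty (y , y∈q) with image y y∈q
  ... | _ , () , _
fibres-bound k R q (outside ∷ p) image fibre =
  fibres-bound k (λ y → R y ∘ suc) q p image′ (λ x x∈p → fibre (suc x) (there x∈p))
  where
  image′ : ∀ y → y ∈ q → ∃[ x ] x ∈ p × R y (suc x)
  image′ y y∈q with image y y∈q
  ... | suc x , there x∈p , r = x , x∈p , r
fibres-bound k R q (inside ∷ p) image fibre with fibre zero here
... | f , ∣f∣≤k , covers = begin
  ∣ q ∣                 ≤⟨ ∣p∣≤∣q∣+∣p∩∁q∣ q f ⟩
  ∣ f ∣ + ∣ q ∩ ∁ f ∣   ≤⟨ ℕ.+-mono-≤ ∣f∣≤k (fibres-bound k (λ y → R y ∘ suc) (q ∩ ∁ f) p image′ fibre′) ⟩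
  k + ∣ p ∣ * k         ∎
  where
  open ℕ.≤-Reasoning
  image′ : ∀ y → y ∈ q ∩ ∁ f → ∃[ x ] x ∈ p × R y (suc x)
  image′ y y∈ with x∈p∩q⁻ q (∁ f) y∈
  ... | y∈q , y∈∁f with image y y∈q
  ... | zero  , _         , r = contradiction (covers y y∈q r) (x∈∁p⇒x∉p y∈∁f)
  ... | suc x , there x∈p , r = x , x∈p , r
  fibre′ : ∀ x → x ∈ p → ∃[ g ] ∣ g ∣ ℕ.≤ k × (∀ y → y ∈ q ∩ ∁ f → R y (suc x) → y ∈ g)
  fibre′ x x∈p with fibre (suc x) (there x∈p)
  ... | g , ∣g∣≤k , covers′ = g , ∣g∣≤k , λ y y∈ → covers′ y (proj₁ (x∈p∩q⁻ q (∁ f) y∈))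

-- Supplies the leaves of a forbidden star when a set of candidates is too large.
≤∣p∣⇒embedding : ∀ {n} m (p : Subset n) → m ℕ.≤ ∣ p ∣ →
  ∃[ f ] Injective {A = Fin m} _≡_ _≡_ f × (∀ i → f i ∈ p)
≤∣p∣⇒embedding zero p _ = (λ ()) , (λ { {()} }) , λ ()
≤∣p∣⇒embedding (suc m) (outside ∷ p) m≤ with ≤∣p∣⇒embedding (suc m) p m≤
... | f , f-inj , f∈ = suc ∘ f , f-inj ∘ suc-injective , there ∘ f∈
≤∣p∣⇒embedding (suc m) (inside ∷ p) (s≤s m≤) with ≤∣p∣⇒embedding m p m≤
... | f , f-inj , f∈ = g , g-inj , λ { zero → here ; (suc i) → there (f∈ i) }
  where
  g = zero Functional.∷ (suc ∘ f)
  g-inj : Injective _≡_ _≡_ g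
  g-inj {zero}  {zero}  _  = refl
  g-inj {zero}  {suc _} ()
  g-inj {suc _} {zero}  ()
  g-inj {suc i} {suc j} eq = cong suc (f-inj (suc-injective eq))

-- Quasi-kernels

module _ {n : ℕ} (D : Digraph n) where

  private
    _⟶_ : Fin n → Fin n → Set
    _⟶_ = Edge D

  sourceless⇒inNeighbour : Sourceless D → ∀ u → ∃[ w ] w ⟶ u
  sourceless⇒inNeighbour noSource u with any? (λ w → edge? D w u)
  ... | yes w⟶u = w⟶u
  ... | no ∄w   = contradiction (u , Empty⇒∣p∣≡0 {p = inNeighbours D u} empty) noSource
    where
    empty : Empty (inNeighbours D u)
    empty (w , w∈) = ∄w (w , ∈-select⁻ (λ v → edge? D v u) w∈)

  -- Distance at most two

  Within2 : Fin n → Fin n → Set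
  Within2 v u = v ≡ u ⊎ v ⟶ u ⊎ ∃[ w ] v ⟶ w × w ⟶ u

  within2? : ∀ v u → Dec (Within2 v u)
  within2? v u = v ≟ u ⊎-dec edge? D v u ⊎-dec any? (λ w → edge? D v w ×-dec edge? D w u)

  path⇒≡ : ∀ {v u} → Path D v u 0 → v ≡ u
  path⇒≡ P = trans (sym (Path.start P)) (Path.end P)

  path⇒⟶ : ∀ {v u} → Path D v u 1 → v ⟶ u
  path⇒⟶ P = subst₂ _⟶_ (Path.start P) (Path.end P) (Path.step P zero)

  -- `Within2` speaks of walks, and its last case may return to `v`, whereas a `Path` has distinct
  -- vertices. So equality and adjacency are decided before `near` is inspected; the negative
  -- answers give minimality, and looplessness separates `w` from both ends.
  within2⇒Dist≤ : ∀ v u → Within2 v u → Dist≤ D v u 2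
  within2⇒Dist≤ v u near with v ≟ u
  ... | yes refl = 0 , (trivial , λ _ _ → z≤n) , z≤n
    where
    trivial : Path D v v 0
    trivial = record
      { vertex = λ _ → v ; start = refl ; end = refl ; step = λ ()
      ; distinct = λ { {zero} {zero} _ → refl } }
  ... | no v≢u with edge? D v u
  ... | yes v⟶u = 1 , (single , minimal) , s≤s z≤n
    where
    single : Path D v u 1
    single = record
      { vertex = λ { zero → v ; (suc _) → u }
      ; start = refl ; end = refl
      ; step = λ { zero → v⟶u }
      ; distinct = λ { {zero}     {zero}     _  → refl
                     ; {zero}     {suc zero} eq → contradiction eq v≢u
                     ; {suc zero} {zero}     eq → contradiction (sym eq) v≢u
                     ; {suc zero} {suc zero} _  → refl } }
    minimal : ∀ l → Path D v u l → 1 ℕ.≤ l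
    minimal zero    P = contradiction (path⇒≡ P) v≢u
    minimal (suc _) _ = s≤s z≤n
  ... | no v↛u with near
  ... | inj₁ v≡u                   = contradiction v≡u v≢u
  ... | inj₂ (inj₁ v⟶u)            = contradiction v⟶u v↛u
  ... | inj₂ (inj₂ (w , v⟶w , w⟶u)) = 2 , (double , minimal) , s≤s (s≤s z≤n)
    where
    v≢w : v ≢ w
    v≢w refl = loopless D v v⟶w
    w≢u : w ≢ u
    w≢u refl = loopless D w w⟶u
    double : Path D v u 2
    double = record
      { vertex = λ { zero → v ; (suc zero) → w ; (suc (suc _)) → u }
      ; start = refl ; end = refl
      ; step = λ { zero → v⟶w ; (suc zero) → w⟶u }
      ; distinct = λ { {zero}           {zero}           _  → refl
                     ; {zero}           {suc zero}       eq → contradiction eq v≢w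
                     ; {zero}           {suc (suc zero)} eq → contradiction eq v≢u
                     ; {suc zero}       {zero}           eq → contradiction (sym eq) v≢w
                     ; {suc zero}       {suc zero}       _  → refl
                     ; {suc zero}       {suc (suc zero)} eq → contradiction eq w≢u
                     ; {suc (suc zero)} {zero}           eq → contradiction (sym eq) v≢u
                     ; {suc (suc zero)} {suc zero}       eq → contradiction (sym eq) w≢u
                     ; {suc (suc zero)} {suc (suc zero)} _  → refl } }
    minimal : ∀ l → Path D v u l → 2 ℕ.≤ l
    minimal 0             P = contradiction (path⇒≡ P) v≢u
    minimal 1             P = contradiction (path⇒⟶ P) v↛u
    minimal (suc (suc _)) _ = s≤s (s≤s z≤n)

  -- Existence of a quasi-kernel

  Covered : Subset n → Fin n → Set
  Covered Q u = ∃[ v ] v ∈ Q × Within2 v u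

  covered? : ∀ Q u → Dec (Covered Q u)
  covered? Q u = any? (λ v → v ∈? Q ×-dec within2? v u)

  Remaining : Subset n → Fin n → Fin n → Set
  Remaining S v u = u ∈ S × v ≢ u × ¬ v ⟶ u

  remaining? : ∀ S v → Decidable (Remaining S v)
  remaining? S v u = u ∈? S ×-dec ¬? (v ≟ u) ×-dec ¬? (edge? D v u)

  remaining⊂ : ∀ {S v} → v ∈ S → select (remaining? S v) ⊂ S
  remaining⊂ {S} {v} v∈S =
      (λ u∈ → proj₁ (∈-select⁻ (remaining? S v) u∈))
    , v , v∈S , λ v∈ → proj₁ (proj₂ (∈-select⁻ (remaining? S v) v∈)) refl

  -- The Chvátal–Lovász argument: delete v together with its out-neighbours.
  quasiKernelOf : ∀ S → Acc _⊂_ S →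
    ∃[ Q ] Q ⊆ S × Independent D Q × (∀ u → u ∈ S → Covered Q u)
  quasiKernelOf S (acc rec) with nonempty? S
  ... | no empty = ⊥ , (λ x∈⊥ → contradiction x∈⊥ ∉⊥) , (λ u _ u∈⊥ → contradiction u∈⊥ ∉⊥)
                 , λ u u∈S → contradiction (u , u∈S) empty
  ... | yes (v , v∈S) with quasiKernelOf (select (remaining? S v)) (rec (remaining⊂ v∈S))
  ... | Q , Q⊆S′ , indep , cover with any? (λ q → q ∈? Q ×-dec edge? D q v)
  -- Through `v`, this `q` reaches every deleted vertex in at most two steps, so `Q` is kept.
  ... | yes (q , q∈Q , q⟶v) = Q , (λ u∈Q → proj₁ (∈-select⁻ (remaining? S v) (Q⊆S′ u∈Q))) , indep , cover′
    where
    cover′ : ∀ u → u ∈ S → Covered Q u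
    cover′ u u∈S with v ≟ u | edge? D v u
    ... | yes refl | _       = q , q∈Q , inj₂ (inj₁ q⟶v)
    ... | no _     | yes v⟶u = q , q∈Q , inj₂ (inj₂ (v , q⟶v , v⟶u))
    ... | no v≢u   | no v↛u  = cover u (∈-select⁺ (remaining? S v) (u∈S , v≢u , v↛u))
  -- Nothing in `Q` points to `v`, and `Q` avoids the out-neighbours of `v` because they were
  -- deleted, so `v` can be added.
  ... | no Q↛v = ⁅ v ⁆ ∪ Q , ⊆S , indep′ , cover′
    where
    ⊆S : ⁅ v ⁆ ∪ Q ⊆ S
    ⊆S u∈ with x∈p∪q⁻ ⁅ v ⁆ Q u∈
    ... | inj₁ u∈v rewrite x∈⁅y⁆⇒x≡y v u∈v = v∈S
    ... | inj₂ u∈Q = proj₁ (∈-select⁻ (remaining? S v) (Q⊆S′ u∈Q))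
    indep′ : Independent D (⁅ v ⁆ ∪ Q)
    indep′ a b a∈ b∈ a⟶b with x∈p∪q⁻ ⁅ v ⁆ Q a∈ | x∈p∪q⁻ ⁅ v ⁆ Q b∈
    ... | inj₂ a∈Q | inj₂ b∈Q = indep a b a∈Q b∈Q a⟶b
    ... | inj₁ a∈v | inj₁ b∈v rewrite x∈⁅y⁆⇒x≡y v a∈v | x∈⁅y⁆⇒x≡y v b∈v = loopless D v a⟶b
    ... | inj₁ a∈v | inj₂ b∈Q rewrite x∈⁅y⁆⇒x≡y v a∈v =
      proj₂ (proj₂ (∈-select⁻ (remaining? S v) (Q⊆S′ b∈Q))) a⟶b
    ... | inj₂ a∈Q | inj₁ b∈v rewrite x∈⁅y⁆⇒x≡y v b∈v = Q↛v (a , a∈Q , a⟶b)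
    v∈ : v ∈ ⁅ v ⁆ ∪ Q
    v∈ = x∈p∪q⁺ (inj₁ (x∈⁅x⁆ v))
    cover′ : ∀ u → u ∈ S → Covered (⁅ v ⁆ ∪ Q) u
    cover′ u u∈S with v ≟ u | edge? D v u
    ... | yes v≡u | _       = v , v∈ , inj₁ v≡u
    ... | no _    | yes v⟶u = v , v∈ , inj₂ (inj₁ v⟶u)
    ... | no v≢u  | no v↛u with cover u (∈-select⁺ (remaining? S v) (u∈S , v≢u , v↛u))
    ... | q , q∈Q , near = q , x∈p∪q⁺ (inj₂ q∈Q) , near

  -- Minimal quasi-kernels

  Irredundant : Subset n → Set
  Irredundant Q = ∀ q → q ∈ Q → ∃[ u ] ¬ Covered (Q - q) u

  irredundantQuasiKernel : ∀ Q → Acc _⊂_ Q → Independent D Q → (∀ u → Covered Q u) →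
    ∃[ Q′ ] Independent D Q′ × (∀ u → Covered Q′ u) × Irredundant Q′
  irredundantQuasiKernel Q (acc rec) indep cover
    with any? (λ q → q ∈? Q ×-dec all? (covered? (Q - q)))
  ... | yes (q , q∈Q , cover′) = irredundantQuasiKernel (Q - q) (rec (x∈p⇒p-x⊂p q∈Q)) indep′ cover′
    where
    indep′ : Independent D (Q - q)
    indep′ a b a∈ b∈ = indep a b (p─q⊆p Q ⁅ q ⁆ a∈) (p─q⊆p Q ⁅ q ⁆ b∈)
  ... | no allNeeded = Q , indep , cover
                     , λ q q∈Q → ¬∀⟶∃¬ n _ (covered? (Q - q)) λ cover′ → allNeeded (q , q∈Q , cover′)

  -- Charging the quasi-kernel to its complement

  OnlyInNeighbour : Subset n → Fin n → Fin n → Set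
  OnlyInNeighbour Q q x = q ⟶ x × (∀ v → v ∈ Q → v ⟶ x → v ≡ q)

  FreeInNeighbour : Subset n → Fin n → Fin n → Set
  FreeInNeighbour Q q x = x ⟶ q × (∀ v → v ∈ Q → ¬ v ⟶ x)

  Charged : Subset n → Fin n → Fin n → Set
  Charged Q q x = OnlyInNeighbour Q q x ⊎ FreeInNeighbour Q q x

  -- Some `u` is within two steps of no member of `Q` except `q`. On a walk of length one or two
  -- from `q` to `u`, the vertex after `q` has no other in-neighbour in `Q`, as that one would also
  -- reach `u`. If only `u = q` is known, an in-neighbour of `q` takes its place.
  irredundant⇒charged : Sourceless D → ∀ {Q} → Independent D Q → (∀ u → Covered Q u) →
    Irredundant Q → ∀ q → q ∈ Q → ∃[ x ] x ∈ ∁ Q × Charged Q q x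
  irredundant⇒charged noSource {Q} indep cover irr q q∈Q with irr q q∈Q
  ... | u , uncovered = helper (cover u)
    where
    only-q : ∀ v → v ∈ Q → Within2 v u → v ≡ q
    only-q v v∈Q near with v ≟ q
    ... | yes v≡q = v≡q
    ... | no v≢q  = contradiction (v , x∈p∧x≢y⇒x∈p-y v∈Q v≢q , near) uncovered
    out-∁ : ∀ {x} → q ⟶ x → x ∈ ∁ Q
    out-∁ {x} q⟶x = x∉p⇒x∈∁p λ x∈Q → indep q x q∈Q x∈Q q⟶x
    fromQ : Within2 q u → ∃[ x ] x ∈ ∁ Q × Charged Q q x
    fromQ (inj₂ (inj₁ q⟶u)) =
      u , out-∁ q⟶u , inj₁ (q⟶u , λ v v∈Q v⟶u → only-q v v∈Q (inj₂ (inj₁ v⟶u)))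
    fromQ (inj₂ (inj₂ (w , q⟶w , w⟶u))) =
      w , out-∁ q⟶w , inj₁ (q⟶w , λ v v∈Q v⟶w → only-q v v∈Q (inj₂ (inj₂ (w , v⟶w , w⟶u))))
    fromQ (inj₁ refl) with sourceless⇒inNeighbour noSource q
    ... | w , w⟶q with edge? D q w
    -- The closed walk through `q`, `w`, `q` reduces this to the case of length two.
    ... | yes q⟶w = fromQ (inj₂ (inj₂ (w , q⟶w , w⟶q)))
    ... | no q↛w  = w , x∉p⇒x∈∁p (λ w∈Q → indep w q w∈Q q∈Q w⟶q) , inj₂ (w⟶q , free)
      where
      free : ∀ v → v ∈ Q → ¬ v ⟶ w
      -- Such a `v` would reach `q` through `w`, hence be `q` itself, against `q↛w`.
      free v v∈Q v⟶w with only-q v v∈Q (inj₂ (inj₂ (w , v⟶w , w⟶q)))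
      ... | refl = q↛w v⟶w
    helper : Covered Q u → ∃[ x ] x ∈ ∁ Q × Charged Q q x
    helper (v , v∈Q , near) with only-q v v∈Q near
    ... | refl = fromQ near

  -- Any `suc k` members of `p` together with `x` would induce the star: independence excludes edges
  -- between leaves, and `out` excludes edges back to the centre.
  starFree⇒outNeighbours≤ : ∀ {k} → D IsFreeOf K⃗₁ (suc k) → ∀ x (p : Subset n) → Independent D p →
    (∀ q → q ∈ p → x ⟶ q × ¬ q ⟶ x) → ∣ p ∣ ℕ.≤ k
  starFree⇒outNeighbours≤ {k} starFree x p indep out = ℕ.≮⇒≥ λ k<∣p∣ →
    let f , f-inj , f∈ = ≤∣p∣⇒embedding (suc k) p k<∣p∣ in starFree (star f f-inj f∈)
    where
    star : (f : Fin (suc k) → Fin n) → Injective _≡_ _≡_ f → (∀ i → f i ∈ p) →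
           InducedSubgraph (K⃗₁ (suc k)) D
    star f f-inj f∈ = g , g-inj , edges
      where
      g = x Functional.∷ f
      x≢f : ∀ i → x ≢ f i
      x≢f i x≡fi = loopless D x (subst (x ⟶_) (sym x≡fi) (proj₁ (out (f i) (f∈ i))))
      g-inj : Injective _≡_ _≡_ g
      g-inj {zero}  {zero}  _  = refl
      g-inj {zero}  {suc j} eq = contradiction eq (x≢f j)
      g-inj {suc i} {zero}  eq = contradiction (sym eq) (x≢f i)
      g-inj {suc i} {suc j} eq = cong suc (f-inj eq)
      edges : ∀ i j → _
      edges zero    zero    = mk⇔ (λ ()) (λ e → contradiction e (loopless D x))
      edges zero    (suc j) = mk⇔ (λ _ → proj₁ (out (f j) (f∈ j))) (λ _ → centre→leaf j)
      edges (suc i) zero    = mk⇔ (λ ()) (λ e → contradiction e (proj₂ (out (f i) (f∈ i))))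
      edges (suc i) (suc j) = mk⇔ (λ ()) (λ e → contradiction e (indep (f i) (f j) (f∈ i) (f∈ j)))

  -- If some `v` in `Q` points to `x`, then `x` is not free and can be charged only by `v`; `1≤k`
  -- admits this singleton. Otherwise every `q` charged to `x` is an out-neighbour of `x` without an
  -- edge back, and star-freeness bounds their number.
  charged-bound : ∀ {k} → 1 ℕ.≤ k → D IsFreeOf K⃗₁ (suc k) → ∀ {Q} → Independent D Q → ∀ x →
    ∃[ f ] ∣ f ∣ ℕ.≤ k × (∀ q → q ∈ Q → Charged Q q x → q ∈ f)
  charged-bound {k} 1≤k starFree {Q} indep x with any? (λ v → v ∈? Q ×-dec edge? D v x)
  ... | yes (v , v∈Q , v⟶x) = ⁅ v ⁆ , subst (ℕ._≤ k) (sym (∣⁅x⁆∣≡1 v)) 1≤k , covers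
    where
    covers : ∀ q → q ∈ Q → Charged Q q x → q ∈ ⁅ v ⁆
    covers q _ (inj₁ (_ , only)) with only v v∈Q v⟶x
    ... | refl = x∈⁅x⁆ v
    covers q _ (inj₂ (_ , free)) = contradiction v⟶x (free v v∈Q)
  ... | no Q↛x = select out? , starFree⇒outNeighbours≤ starFree x _ indep′ out , covers
    where
    out? : Decidable (λ q → q ∈ Q × x ⟶ q)
    out? q = q ∈? Q ×-dec edge? D x q
    indep′ : Independent D (select out?)
    indep′ a b a∈ b∈ = indep a b (proj₁ (∈-select⁻ out? a∈)) (proj₁ (∈-select⁻ out? b∈))
    out : ∀ q → q ∈ select out? → x ⟶ q × ¬ q ⟶ x
    out q q∈ = let q∈Q , x⟶q = ∈-select⁻ out? q∈ in x⟶q , λ q⟶x → Q↛x (q , q∈Q , q⟶x)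
    covers : ∀ q → q ∈ Q → Charged Q q x → q ∈ select out?
    covers q q∈Q (inj₁ (q⟶x , _)) = contradiction (q , q∈Q , q⟶x) Q↛x
    covers q q∈Q (inj₂ (x⟶q , _)) = ∈-select⁺ out? (q∈Q , x⟶q)

  smallQuasiKernel : ∀ {k} → 1 ℕ.≤ k → Sourceless D → D IsFreeOf K⃗₁ (suc k) →
    ∃[ Q ] IsQuasiKernel D Q × ∣ Q ∣ ℕ.≤ (n ∸ ∣ Q ∣) * k
  smallQuasiKernel {k} 1≤k noSource starFree =
    let Q₀ , _ , indep₀ , cover₀ = quasiKernelOf ⊤ (⊂-wellFounded ⊤)
        Q , indep , cover , irr  =
          irredundantQuasiKernel Q₀ (⊂-wellFounded Q₀) indep₀ (λ u → cover₀ u ∈⊤)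
        bound = fibres-bound k (Charged Q) Q (∁ Q)
                  (irredundant⇒charged noSource indep cover irr)
                  (λ x _ → charged-bound 1≤k starFree indep x)
        reach : ∀ u → ∃[ v ] v ∈ Q × Dist≤ D v u 2
        reach u = let v , v∈Q , near = cover u in v , v∈Q , within2⇒Dist≤ v u near
    in Q , (indep , reach) , subst (λ c → ∣ Q ∣ ℕ.≤ c * k) (∣∁p∣≡n∸∣p∣ Q) bound

-- With k = d - 1 = j + 1 this is q (1 + k + k²) ≤ (k² + 1) (q + c), which after
-- cancelling q (1 + k²) reads q k ≤ c k² + c.
ratio-bound : ∀ j q c → q ℕ.≤ c * suc j → let d = suc (suc j) in
  q * (1 + (d ^ 2 ∸ d)) ℕ.≤ (d ^ 2 ∸ 2 * d + 2) * (q + c)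
ratio-bound j q c q≤ = begin
  q * (1 + (d ^ 2 ∸ d))                  ≡⟨ cong (λ e → q * (1 + e)) d²∸d ⟩
  q * (1 + d * suc j)                    ≡⟨ lhs j q ⟩
  q * (1 + suc j * suc j) + q * suc j    ≤⟨ ℕ.+-monoʳ-≤ (q * (1 + suc j * suc j)) (ℕ.*-monoˡ-≤ (suc j) q≤) ⟩
  q * (1 + suc j * suc j) + c * suc j * suc j      ≤⟨ ℕ.m≤n+m _ c ⟩
  -- The summand `c` is the slack between `c * k * k` and the right-hand side.
  c + (q * (1 + suc j * suc j) + c * suc j * suc j) ≡⟨ rhs j q c ⟩
  (j * j + 2 * j + 2) * (q + c)          ≡⟨ cong (λ e → (e + 2) * (q + c)) d²∸2d ⟨
  (d ^ 2 ∸ 2 * d + 2) * (q + c)          ∎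
  where
  open ℕ.≤-Reasoning
  d = suc (suc j)
  -- Truncated subtraction is removed by writing the minuend as a sum; `expand` spells `d ^ 2` in
  -- its unfolded form, with the final factor 1.
  d²∸d : d ^ 2 ∸ d ≡ d * suc j
  d²∸d = trans (cong (_∸ d) (expand j)) (ℕ.m+n∸n≡m (d * suc j) d)
    where
    expand : ∀ j → (2 + j) * ((2 + j) * 1) ≡ (2 + j) * (1 + j) + (2 + j)
    expand = solve-∀
  d²∸2d : d ^ 2 ∸ 2 * d ≡ j * j + 2 * j
  d²∸2d = trans (cong (_∸ 2 * d) (expand j)) (ℕ.m+n∸n≡m (j * j + 2 * j) (2 * d))
    where
    expand : ∀ j → (2 + j) * ((2 + j) * 1) ≡ j * j + 2 * j + 2 * (2 + j)
    expand = solve-∀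
  lhs : ∀ j q → q * (1 + (2 + j) * (1 + j)) ≡ q * (1 + (1 + j) * (1 + j)) + q * (1 + j)
  lhs = solve-∀
  rhs : ∀ j q c → c + (q * (1 + (1 + j) * (1 + j)) + c * (1 + j) * (1 + j)) ≡ (j * j + 2 * j + 2) * (q + c)
  rhs = solve-∀

corollary1p3 : ∀ (d : ℕ) → d ≥ 3 → ∀ (n : ℕ) (D : Digraph n) →
    Sourceless D → D IsFreeOf K⃗₁ d →
    ∃[ Q ] IsQuasiKernel D Q ×
    + ∣ Q ∣ / 1 ≤ + ((d ^ 2 ∸ 2 * d + 2) * n) / (1 + (d ^ 2 ∸ d))
corollary1p3 d@(suc (suc j)) _ n D noSource starFree =
  let Q , isQK , small = smallQuasiKernel D (s≤s z≤n) noSource starFree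
      -- Cross-multiplied form of the inequality of fractions; the last factor 1 is the denominator
      -- of `+ ∣ Q ∣ / 1`.
      bound : ∣ Q ∣ * (1 + (d ^ 2 ∸ d)) ℕ.≤ (d ^ 2 ∸ 2 * d + 2) * n * 1
      bound = begin
        ∣ Q ∣ * (1 + (d ^ 2 ∸ d))
          ≤⟨ ratio-bound j ∣ Q ∣ (n ∸ ∣ Q ∣) small ⟩
        (d ^ 2 ∸ 2 * d + 2) * (∣ Q ∣ + (n ∸ ∣ Q ∣))
          ≡⟨ cong ((d ^ 2 ∸ 2 * d + 2) *_) (ℕ.m+[n∸m]≡n (∣p∣≤n Q)) ⟩
        (d ^ 2 ∸ 2 * d + 2) * n
          ≡⟨ ℕ.*-identityʳ _ ⟨
        (d ^ 2 ∸ 2 * d + 2) * n * 1 ∎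
  in Q , isQK , *≤* (subst₂ ℤ._≤_ (pos-* ∣ Q ∣ _) (pos-* ((d ^ 2 ∸ 2 * d + 2) * n) 1) (+≤+ bound))
  where open ℕ.≤-Reasoning
corollary1p3 (suc zero) (s≤s ())
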